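{- For any $s,t\in\mathbb N$ and $\varepsilon>0$ there exist $n_0=n_{\varepsilon,s,t}$ and $\delta>0$ such that any $\mathcal F\subseteq 2^{[n]}$ of size at least $(2+\varepsilon)\binom{n}{\lfloor n/2\rfloor}$ with $n\ge n_0$ contains at least $\delta n^{s+t}\binom{n}{\lfloor n/2\rfloor}$ induced copies of $K_{s,1,t}$.
   Context: For a finite poset $(P,\le)$ and $\mathcal F\subseteq 2^{[n]}$, an induced copy of $P$ in $\mathcal F$ is a subfamily $\mathcal G\subseteq\mathcal F$ with a bijection $i:P\to\mathcal G$ such that for all $p,q\in P$, $p\le q$ if and only if $i(p)\subseteq i(q)$. $K_{s,1,t}$ is the poset on elements $a_1,\dots,a_s,b,c_1,\dots,c_t$ where $a_j<b<c_k$ for all $j,k$ (hence $a_j<c_k$), and the $a_j$ are pairwise incomparable and the $c_k$ are pairwise incomparable. -}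

module Defs where

open import Data.Nat using (ℕ; _/_)
open import Data.Nat.Combinatorics using (_C_)
open import Data.Fin using (Fin)
open import Data.Fin.Subset using (Subset; _⊆_)
open import Data.Sum using (_⊎_; inj₁; inj₂)
open import Data.Unit using (⊤; tt)
open import Data.Product using (_×_; Σ; ∃; _,_)
open import Data.List using (List)
open import Data.List.Membership.Propositional using (_∈_)
open import Relation.Binary.PropositionalEquality using (_≡_)
open import Relation.Nullary using (¬_)
open import Data.Integer using (+_)
import Data.Rational as ℚ

data KElem (s t : ℕ) : Set where
  a : Fin s → KElem s t
  b : KElem s t
  c : Fin t → KElem s t

data _≤K_ {s t : ℕ} : KElem s t → KElem s t → Set where
  a≤a : ∀ {j} → a j ≤K a j
  a≤b : ∀ {j} → a j ≤K b
  a≤c : ∀ {j k} → a j ≤K c k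
  b≤b : b ≤K b
  b≤c : ∀ {k} → b ≤K c k
  c≤c : ∀ {k} → c k ≤K c k

-- An induced copy of K_{s,1,t} in the family F ⊆ 2^[n], given by the map
-- i : K_{s,1,t} → 2^[n] (injectivity follows from the order-embedding
-- property by antisymmetry); the copy itself is the image subfamily.
record InducedCopy (s t n : ℕ) (F : List (Subset n)) : Set where
  field
    emb      : KElem s t → Subset n
    inFamily : ∀ p → emb p ∈ F
    induced  : ∀ p q → (p ≤K q → emb p ⊆ emb q) × (emb p ⊆ emb q → p ≤K q)

open InducedCopy public

SameSubfamily : ∀ {s t n F} → InducedCopy s t n F → InducedCopy s t n F → Set
SameSubfamily G H =
  (∀ p → ∃ λ q → emb G p ≡ emb H q) × (∀ q → ∃ λ p → emb H q ≡ emb G p)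

DistinctCopies : ∀ {s t n F} → InducedCopy s t n F → InducedCopy s t n F → Set
DistinctCopies G H = ¬ SameSubfamily G H

ℕ→ℚ : ℕ → ℚ.ℚ
ℕ→ℚ m = + m ℚ./ 1

midBinom : ℕ → ℕ
midBinom n = n C (n / 2)

{-# OPTIONS --safe #-}
module Submission where

-- Call b ∈ F rich if its size is at least a small constant times n and some level contains at least N = Θ(n) members
-- of F below b. A member of F that is rich both in F and, after complementation, in { ∁ A : A ∈ F }
-- is the middle element of Θ(n^(s+t)) induced copies, since each level is an antichain. Hence it suffices
-- that for any η > 0 and suitable N at most (1 + η) (n choose n/2) members of F are not rich.
-- Sets of size less than a small constant times n are negligible. Let G consist of the other members that are not
-- rich. For b ∈ G of size r, the sets of G strictly below b lie, counted with multiplicity, on at most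
-- N Σ_{0<k<r} k! (r-k)! ≤ 4 N (r-1)! of the r! maximal chains of [∅, b], which is a small fraction of r!.
-- This local bound extends to [∅, B] for every B by induction on ∣ B ∣: for B ∉ G the chains of [∅, B] are
-- distributed over the lower covers of B. For B = [n] this is a LYM inequality for G with constant 1 + η.

open import Defs
import Algebra.Properties.CommutativeSemigroup
open import Data.Bool using (true; if_then_else_)
import Data.Bool.Properties as Bool
open import Data.Empty using (⊥; ⊥-elim)
open import Data.Fin using (Fin; zero; suc; combine; remQuot; finToFun; funToFin; inject≤)
open import Data.Fin.Properties using (combine-injective; combine-injectiveˡ; combine-remQuot; funToFin-finToFin; inject≤-injective)
open import Data.Fin.Subset using (Subset; _⊆_; ∣_∣; inside; outside; ⊤; ∁)
open import Data.Fin.Subset.Properties using (_⊆?_; p⊆q⇒∣p∣≤∣q∣; drop-∷-⊆; ⊆⊤; ∣⊤∣≡n; ∣p∣≤n; p⊆q⇒∁p⊇∁q; ∁p⊆∁q⇒p⊇q; ⊆-trans; ⊆-reflexive)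
import Data.Integer as ℤ
import Data.Integer.Properties as ℤ
open import Data.List using (List; []; _∷_; length; filter; map; lookup; tabulate)
open import Data.List.Membership.Propositional using () renaming (_∈_ to _∈ₗ_)
import Data.List.Membership.DecPropositional as DecMembership
open import Data.List.Membership.Propositional.Properties using (∈-map⁻; ∈-filter⁻; ∈-lookup)
open import Data.List.Properties using (length-map; map-∘; filter-all; length-tabulate)
open import Data.List.Relation.Binary.Sublist.Propositional.Properties using (filter⁺; filter-⊆; length-mono-≤)
open import Data.List.Relation.Unary.All as All using (_∷_)
open import Data.List.Relation.Unary.AllPairs using (AllPairs; _∷_)
import Data.List.Relation.Unary.AllPairs.Properties as AllPairs
open import Data.List.Relation.Unary.Any using (here; there)
open import Data.List.Relation.Unary.Unique.Propositional using (Unique)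
import Data.List.Relation.Unary.Unique.Propositional.Properties as Unique
open import Data.Nat using (ℕ; zero; suc; _+_; _*_; _∸_; _^_; _/_; _!; _≤_; _<_; _≥_; z≤n; s≤s; NonZero)
open import Data.Nat.Combinatorics using (_C_; nCk≡n!/k![n-k]!; k![n∸k]!∣n!)
open import Data.Nat.Coprimality using (1-coprimeTo)
open import Data.Nat.DivMod using (m/n*n≡m; m/n≤m; m/n*n≤m; m≡m%n+[m/n]*n; m%n<n; m*n/n≡m; /-monoˡ-≤; m≥n⇒m/n>0)
open import Data.Nat.ListAction using (sum)
open import Data.Nat.Properties
open import Data.Nat.Tactic.RingSolver using (solve-∀)
open import Data.Product using (Σ; ∃; _×_; _,_; proj₁; proj₂; uncurry)
open import Data.Rational using (ℚ; mkℚ; 0ℚ; toℚᵘ; ↧ₙ_) renaming (_<_ to _<ℚ_; _≤_ to _≤ℚ_; _*_ to _*ℚ_; _+_ to _+ℚ_; *<* to *<*ℚ)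
import Data.Rational.Properties as ℚ
open import Data.Rational.Unnormalised as ℚᵘ using (mkℚᵘ; _≃_; *≤*)
import Data.Rational.Unnormalised.Properties as ℚᵘ
open import Data.Sum using (_⊎_; inj₁; inj₂; [_,_]′)
open import Data.Vec using ([]; _∷_; here)
import Data.Vec.Properties as Vec
open import Function using (_∘_)
open import Relation.Binary using (DecidableEquality)
open import Relation.Binary.PropositionalEquality using (_≡_; _≢_; _≗_; refl; sym; trans; cong; cong₂; subst; subst₂; module ≡-Reasoning)
open import Relation.Nullary using (¬_; yes; no; does; contradiction; _×-dec_; ¬?)
open import Relation.Nullary.Decidable using (dec-true; toSum)
open import Relation.Unary using (Decidable)
open import Relation.Unary.Properties using (U?)

module +-CS = Algebra.Properties.CommutativeSemigroup +-commutativeSemigroup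
module *-CS = Algebra.Properties.CommutativeSemigroup *-commutativeSemigroup

private
  variable
    n N N′ : ℕ
    A B : Set

-- Finite sums

∑ : (A → ℕ) → List A → ℕ
∑ f xs = sum (map f xs)

∑-mono : {f g : A → ℕ} → ∀ xs → (∀ {x} → x ∈ₗ xs → f x ≤ g x) → ∑ f xs ≤ ∑ g xs
∑-mono []       f≤g = z≤n
∑-mono (x ∷ xs) f≤g = +-mono-≤ (f≤g (here refl)) (∑-mono xs (f≤g ∘ there))

∑-const : ∀ w (xs : List A) → ∑ (λ _ → w) xs ≡ length xs * w
∑-const w []       = refl
∑-const w (x ∷ xs) = cong (w +_) (∑-const w xs)

∑-distrib-+ : ∀ (f g : A → ℕ) xs → ∑ (λ x → f x + g x) xs ≡ ∑ f xs + ∑ g xs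
∑-distrib-+ f g []       = refl
∑-distrib-+ f g (x ∷ xs) = trans (cong (f x + g x +_) (∑-distrib-+ f g xs)) (+-CS.interchange (f x) (g x) (∑ f xs) (∑ g xs))

∑-*ˡ : ∀ w (f : A → ℕ) xs → ∑ (λ x → w * f x) xs ≡ w * ∑ f xs
∑-*ˡ w f []       = sym (*-zeroʳ w)
∑-*ˡ w f (x ∷ xs) = trans (cong (w * f x +_) (∑-*ˡ w f xs)) (sym (*-distribˡ-+ w (f x) _))

∑-swap : {B : Set} (f : A → B → ℕ) → ∀ xs ys →
  ∑ (λ x → ∑ (f x) ys) xs ≡ ∑ (λ y → ∑ (λ x → f x y) xs) ys
∑-swap f []       ys = sym (trans (∑-const 0 ys) (*-zeroʳ (length ys)))
∑-swap f (x ∷ xs) ys = trans (cong (∑ (f x) ys +_) (∑-swap f xs ys)) (sym (∑-distrib-+ (f x) _ ys))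

∑< : ℕ → (ℕ → ℕ) → ℕ
∑< zero    f = 0
∑< (suc n) f = ∑< n f + f n

∑<-mono : ∀ {f g} n → (∀ {k} → k < n → f k ≤ g k) → ∑< n f ≤ ∑< n g
∑<-mono zero    f≤g = z≤n
∑<-mono (suc n) f≤g = +-mono-≤ (∑<-mono n (f≤g ∘ m<n⇒m<1+n)) (f≤g ≤-refl)

∑<-const : ∀ n w → ∑< n (λ _ → w) ≡ n * w
∑<-const zero    w = refl
∑<-const (suc n) w = trans (cong (_+ w) (∑<-const n w)) (+-comm (n * w) w)

∑<-*ˡ : ∀ w f n → ∑< n (λ k → w * f k) ≡ w * ∑< n f
∑<-*ˡ w f zero    = sym (*-zeroʳ w)
∑<-*ˡ w f (suc n) = trans (cong (_+ w * f n) (∑<-*ˡ w f n)) (sym (*-distribˡ-+ w _ (f n)))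

∑<-head : ∀ f n → ∑< (suc n) f ≡ f 0 + ∑< n (f ∘ suc)
∑<-head f zero    = sym (+-identityʳ (f 0))
∑<-head f (suc n) = trans (cong (_+ f (suc n)) (∑<-head f n)) (+-assoc (f 0) _ _)

-- One index with room for the extra `w` is enough. In `∑-fibres` this charges a new list element to
-- the single fibre chosen for it.
∑<-mono-+ : ∀ {f g w k} n → (∀ j → f j ≤ g j) → k < n → w + f k ≤ g k → w + ∑< n f ≤ ∑< n g
∑<-mono-+ {f} {g} {w} {k} (suc n) f≤g k<1+n w+fk≤gk with k ≟ n
... | yes refl = begin
  w + (∑< n f + f n)  ≡⟨ +-CS.x∙yz≈y∙xz w (∑< n f) (f n) ⟩
  ∑< n f + (w + f n)  ≤⟨ +-mono-≤ (∑<-mono n (λ {j} _ → f≤g j)) w+fk≤gk ⟩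
  ∑< n g + g n        ∎
  where open ≤-Reasoning
... | no k≢n = begin
  w + (∑< n f + f n)  ≡⟨ +-assoc w _ _ ⟨
  w + ∑< n f + f n    ≤⟨ +-mono-≤ (∑<-mono-+ n f≤g (≤∧≢⇒< (≤-pred k<1+n) k≢n) w+fk≤gk) (f≤g n) ⟩
  ∑< n g + g n        ∎
  where open ≤-Reasoning

-- Each element of nonzero weight is charged to one index only, so the fibres may overlap. This
-- turns a sum over a family into level sizes times one weight per level.
∑-fibres : {P : ℕ → A → Set} (P? : ∀ k → Decidable (P k)) (f : A → ℕ) (φ : ℕ → ℕ) (n : ℕ) (xs : List A) →
  (∀ {x} → x ∈ₗ xs → f x ≡ 0 ⊎ ∃ λ k → k < n × P k x × f x ≤ φ k) →
  ∑ f xs ≤ ∑< n (λ k → length (filter (P? k) xs) * φ k)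
∑-fibres P? f φ n []       h = z≤n
∑-fibres {P = P} P? f φ n (x ∷ xs) h = ≤-trans (+-monoʳ-≤ (f x) (∑-fibres P? f φ n xs (h ∘ there))) (step (h (here refl)))
  where
  grow : ∀ k → length (filter (P? k) xs) ≤ length (filter (P? k) (x ∷ xs))
  grow k with P? k x
  ... | yes _ = n≤1+n _
  ... | no  _ = ≤-refl

  grow-suc : ∀ k → P k x → suc (length (filter (P? k) xs)) ≤ length (filter (P? k) (x ∷ xs))
  grow-suc k p with P? k x
  ... | yes _ = ≤-refl
  ... | no ¬p = contradiction p ¬p

  weighted : ∀ k → length (filter (P? k) xs) * φ k ≤ length (filter (P? k) (x ∷ xs)) * φ k
  weighted k = *-monoˡ-≤ (φ k) (grow k)

  step : (f x ≡ 0 ⊎ ∃ λ k → k < n × P k x × f x ≤ φ k) →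
    f x + ∑< n (λ k → length (filter (P? k) xs) * φ k) ≤ ∑< n (λ k → length (filter (P? k) (x ∷ xs)) * φ k)
  step (inj₁ fx≡0) rewrite fx≡0 = ∑<-mono n (λ {k} _ → weighted k)
  step (inj₂ (k , k<n , p , fx≤)) = ∑<-mono-+ n weighted k<n
    (≤-trans (+-monoˡ-≤ _ fx≤) (*-monoˡ-≤ (φ k) (grow-suc k p)))

-- Factorials and binomial coefficients

-- Raising `i` by one multiplies the left side by `k + i + 1` and the right side by `l + i + 1`,
-- which is no smaller.
!*!-spread : ∀ {k l} → k ≤ l → ∀ i → (k + i) ! * l ! ≤ k ! * (l + i) !
!*!-spread {k} {l} k≤l zero    rewrite +-identityʳ k | +-identityʳ l = ≤-refl
!*!-spread {k} {l} k≤l (suc i) rewrite +-suc k i | +-suc l i = begin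
  suc (k + i) * (k + i) ! * l !    ≡⟨ *-assoc (suc (k + i)) ((k + i) !) (l !) ⟩
  suc (k + i) * ((k + i) ! * l !)  ≤⟨ *-mono-≤ (s≤s (+-monoˡ-≤ i k≤l)) (!*!-spread k≤l i) ⟩
  suc (l + i) * (k ! * (l + i) !)  ≡⟨ *-CS.x∙yz≈y∙xz (suc (l + i)) (k !) ((l + i) !) ⟩
  k ! * (suc (l + i) * (l + i) !)  ∎
  where open ≤-Reasoning

2*[n/2]≤n : ∀ n → n / 2 + n / 2 ≤ n
2*[n/2]≤n n = subst (_≤ n) (eq (n / 2)) (m/n*n≤m n 2)
  where
  eq : ∀ x → x * 2 ≡ x + x
  eq = solve-∀

m<[1+m/n]*n : ∀ m n .{{_ : NonZero n}} → m < suc (m / n) * n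
m<[1+m/n]*n m n = subst (_< suc (m / n) * n) (sym (m≡m%n+[m/n]*n m n)) (+-monoˡ-< (m / n * n) (m%n<n m n))

-- By symmetry `k ≤ l` may be assumed. Passing from the halves `h ≤ g` to `k` and `l` moves both
-- entries outwards by `h ∸ k`, which does not lower the product, by `!*!-spread`.
half!*half!≤ : ∀ k l → ((k + l) / 2) ! * (k + l ∸ (k + l) / 2) ! ≤ k ! * l !
half!*half!≤ k l = [ sorted k l , (λ l≤k →
  subst₂ (λ n v → (n / 2) ! * (n ∸ n / 2) ! ≤ v) (+-comm l k) (*-comm (l !) (k !)) (sorted l k l≤k)) ]′ (≤-total k l)
  where
  sorted : ∀ k l → k ≤ l → ((k + l) / 2) ! * (k + l ∸ (k + l) / 2) ! ≤ k ! * l !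
  sorted k l k≤l = subst (λ z → h ! * g ! ≤ k ! * z !) g+[h∸k]≡l
    (subst (λ z → z ! * g ! ≤ k ! * (g + (h ∸ k)) !) (m+[n∸m]≡n k≤h) (!*!-spread (≤-trans k≤h h≤g) (h ∸ k)))
    where
    h = (k + l) / 2
    g = k + l ∸ h
    h≤g : h ≤ g
    h≤g = m+n≤o⇒m≤o∸n h (2*[n/2]≤n (k + l))
    k≤h : k ≤ h
    k≤h = ≤-trans (≤-reflexive (sym (m*n/n≡m k 2))) (/-monoˡ-≤ 2 (subst (_≤ k + l) (eq k) (+-monoʳ-≤ k k≤l)))
      where
      eq : ∀ x → x + x ≡ x * 2
      eq = solve-∀
    g+[h∸k]≡l : g + (h ∸ k) ≡ l
    g+[h∸k]≡l = +-cancelˡ-≡ k _ _ (trans (+-CS.x∙yz≈y∙xz k g (h ∸ k))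
      (trans (cong (g +_) (m+[n∸m]≡n k≤h)) (m∸n+n≡m (m/n≤m (k + l) 2))))

nCk*[k!*[n∸k]!]≡n! : ∀ {n k} → k ≤ n → (n C k) * (k ! * (n ∸ k) !) ≡ n !
nCk*[k!*[n∸k]!]≡n! {n} {k} k≤n = trans (cong (_* (k ! * (n ∸ k) !)) (nCk≡n!/k![n-k]! k≤n)) (m/n*n≡m (k![n∸k]!∣n! k≤n))
  where instance _ = k !* (n ∸ k) !≢0

-- The form needed for LYM: a set of size `k` lies on at least a fraction 1 / `midBinom n` of the
-- `n !` maximal chains.
n!≤midBinom*k!*[n∸k]! : ∀ {n k} → k ≤ n → n ! ≤ midBinom n * (k ! * (n ∸ k) !)
n!≤midBinom*k!*[n∸k]! {n} {k} k≤n = begin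
  n !                                            ≡⟨ nCk*[k!*[n∸k]!]≡n! (m/n≤m n 2) ⟨
  midBinom n * ((n / 2) ! * (n ∸ n / 2) !)       ≤⟨ *-monoʳ-≤ (midBinom n)
    (subst (λ z → (z / 2) ! * (z ∸ z / 2) ! ≤ k ! * (n ∸ k) !) (m+[n∸m]≡n k≤n) (half!*half!≤ k (n ∸ k))) ⟩
  midBinom n * (k ! * (n ∸ k) !)                 ∎
  where open ≤-Reasoning

nCk≤midBinom : ∀ {n k} → k ≤ n → n C k ≤ midBinom n
nCk≤midBinom {n} {k} k≤n = *-cancelʳ-≤ (n C k) (midBinom n) (k ! * (n ∸ k) !)
  (≤-trans (≤-reflexive (nCk*[k!*[n∸k]!]≡n! k≤n)) (n!≤midBinom*k!*[n∸k]! k≤n))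
  where instance _ = k !* (n ∸ k) !≢0

[1+k]*nC[1+k] : ∀ {n k} → k < n → suc k * (n C suc k) ≡ (n ∸ k) * (n C k)
[1+k]*nC[1+k] {n} {k} k<n = *-cancelʳ-≡ _ _ (k ! * (n ∸ suc k) !) (begin
  suc k * (n C suc k) * (k ! * (n ∸ suc k) !)          ≡⟨ eq₁ (suc k) (n C suc k) (k !) ((n ∸ suc k) !) ⟩
  (n C suc k) * (suc k ! * (n ∸ suc k) !)              ≡⟨ nCk*[k!*[n∸k]!]≡n! k<n ⟩
  n !                                                  ≡⟨ nCk*[k!*[n∸k]!]≡n! (<⇒≤ k<n) ⟨
  (n C k) * (k ! * (n ∸ k) !)                          ≡⟨ cong (λ z → (n C k) * (k ! * z !)) n∸k≡ ⟩
  (n C k) * (k ! * (suc (n ∸ suc k) * (n ∸ suc k) !))  ≡⟨ eq₂ (n C k) (k !) (suc (n ∸ suc k)) ((n ∸ suc k) !) ⟩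
  suc (n ∸ suc k) * (n C k) * (k ! * (n ∸ suc k) !)    ≡⟨ cong (λ z → z * (n C k) * (k ! * (n ∸ suc k) !)) n∸k≡ ⟨
  (n ∸ k) * (n C k) * (k ! * (n ∸ suc k) !)            ∎)
  where
  open ≡-Reasoning
  instance _ = k !* (n ∸ suc k) !≢0
  n∸k≡ : n ∸ k ≡ suc (n ∸ suc k)
  n∸k≡ = +-∸-assoc 1 k<n
  eq₁ : ∀ x y z w → x * y * (z * w) ≡ y * (x * z * w)
  eq₁ = solve-∀
  eq₂ : ∀ x y z w → x * (y * (z * w)) ≡ z * x * (y * w)
  eq₂ = solve-∀

-- In this range consecutive binomial coefficients have ratio `(n ∸ j) / (1 + j)`, which is at least
-- `1 + d`, so they grow geometrically and the next one dominates the sum.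
d*∑C≤C : ∀ {n} d j → (2 + d) * j ≤ n → d * ∑< j (n C_) ≤ n C j
d*∑C≤C {n} d zero    _ = ≤-trans (≤-reflexive (*-zeroʳ d)) z≤n
d*∑C≤C {n} d (suc j) [2+d][1+j]≤n = begin
  d * (∑< j (n C_) + (n C j))       ≡⟨ *-distribˡ-+ d _ (n C j) ⟩
  d * ∑< j (n C_) + d * (n C j)     ≤⟨ +-monoˡ-≤ _ (d*∑C≤C d j (≤-trans (*-monoʳ-≤ (2 + d) (n≤1+n j)) [2+d][1+j]≤n)) ⟩
  (1 + d) * (n C j)                 ≤⟨ *-cancelˡ-≤ (suc j) ratio ⟩
  n C suc j                         ∎
  where
  open ≤-Reasoning
  j<n : j < n
  j<n = ≤-trans (m≤m+n (suc j) _) [2+d][1+j]≤n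
  eq : ∀ d j → (1 + j) * (1 + d) + j + 1 ≡ (2 + d) * (1 + j)
  eq = solve-∀
  ratio : suc j * ((1 + d) * (n C j)) ≤ suc j * (n C suc j)
  ratio = begin
    suc j * ((1 + d) * (n C j))  ≡⟨ *-assoc (suc j) (1 + d) _ ⟨
    suc j * (1 + d) * (n C j)    ≤⟨ *-monoˡ-≤ (n C j) (m+n≤o⇒m≤o∸n (suc j * (1 + d))
      (≤-trans (m≤m+n _ 1) (≤-trans (≤-reflexive (eq d j)) [2+d][1+j]≤n))) ⟩
    (n ∸ j) * (n C j)            ≡⟨ [1+k]*nC[1+k] j<n ⟨
    suc j * (n C suc j)          ∎

-- Raising `k` by one multiplies the left side by `3 + k` and the right side by `3 + (k + l)`. It
-- bounds the interior terms of the sum that follows.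
[2+k]!*[2+l]!≤ : ∀ k l → (2 + k) ! * (2 + l) ! ≤ 2 * (2 + (k + l)) !
[2+k]!*[2+l]!≤ zero    l = ≤-refl
[2+k]!*[2+l]!≤ (suc k) l = begin
  (3 + k) * (2 + k) ! * (2 + l) !        ≡⟨ *-assoc (3 + k) ((2 + k) !) _ ⟩
  (3 + k) * ((2 + k) ! * (2 + l) !)      ≤⟨ *-mono-≤ (+-monoʳ-≤ 3 (m≤m+n k l)) ([2+k]!*[2+l]!≤ k l) ⟩
  (3 + (k + l)) * (2 * (2 + (k + l)) !)  ≡⟨ *-CS.x∙yz≈y∙xz (3 + (k + l)) 2 ((2 + (k + l)) !) ⟩
  2 * ((3 + (k + l)) * (2 + (k + l)) !)  ∎
  where open ≤-Reasoning

-- For `q ≥ 2` the two end terms are `q !` each, and each of the `q ∸ 2` interior terms is at most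
-- `2 * (q ∸ 1) !`, so these add at most `2 * q !`.
∑[1+k]!*[q∸k]!≤4*q! : ∀ q → ∑< q (λ k → (suc k) ! * (q ∸ k) !) ≤ 4 * q !
∑[1+k]!*[q∸k]!≤4*q! zero = z≤n
∑[1+k]!*[q∸k]!≤4*q! (suc zero) = s≤s z≤n
∑[1+k]!*[q∸k]!≤4*q! (suc (suc q)) = begin
  ∑< (suc q) term + term (suc q)                              ≡⟨ cong (_+ term (suc q)) (∑<-head term q) ⟩
  term 0 + ∑< q (term ∘ suc) + term (suc q)                   ≤⟨ +-mono-≤ (+-monoʳ-≤ (term 0) (∑<-mono q middle)) (≤-reflexive last) ⟩
  term 0 + ∑< q (λ _ → 2 * (suc q) !) + (2 + q) !             ≡⟨ cong (λ z → term 0 + z + (2 + q) !) (∑<-const q _) ⟩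
  1 * (2 + q) ! + q * (2 * (suc q) !) + (2 + q) !             ≤⟨ +-monoˡ-≤ ((2 + q) !) (+-monoʳ-≤ (1 * (2 + q) !) (*-monoˡ-≤ (2 * (suc q) !) (m≤n+m q 2))) ⟩
  1 * (2 + q) ! + (2 + q) * (2 * (suc q) !) + (2 + q) !       ≡⟨ eq (2 + q) ((suc q) !) ⟩
  4 * (2 + q) !                                               ∎
  where
  open ≤-Reasoning
  term : ℕ → ℕ
  term k = (suc k) ! * (2 + q ∸ k) !
  eq : ∀ x y → 1 * (x * y) + x * (2 * y) + x * y ≡ 4 * (x * y)
  eq = solve-∀
  last : term (suc q) ≡ (2 + q) !
  last = trans (cong (λ z → (2 + q) ! * z !) (m+n∸n≡m 1 q)) (*-identityʳ _)
  middle : ∀ {k} → k < q → term (suc k) ≤ 2 * (suc q) !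
  middle {k} k<q = subst₂ (λ x y → (2 + k) ! * x ! ≤ 2 * y !) 2+l≡ 2+[k+l]≡ ([2+k]!*[2+l]!≤ k (q ∸ suc k))
    where
    2+l≡ : 2 + (q ∸ suc k) ≡ suc q ∸ k
    2+l≡ = trans (cong suc (sym (+-∸-assoc 1 k<q))) (sym (+-∸-assoc 1 (<⇒≤ k<q)))
    2+[k+l]≡ : 2 + (k + (q ∸ suc k)) ≡ suc q
    2+[k+l]≡ = cong suc (m+[n∸m]≡n k<q)

-- Chains through a family of sets

_≟ₛ_ : DecidableEquality (Subset n)
_≟ₛ_ = Vec.≡-dec Bool._≟_

⊆∧∣≥∣⇒≡ : (p q : Subset n) → p ⊆ q → ∣ q ∣ ≤ ∣ p ∣ → p ≡ q
⊆∧∣≥∣⇒≡ []            []            p⊆q q≤p = refl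
⊆∧∣≥∣⇒≡ (outside ∷ p) (outside ∷ q) p⊆q q≤p = cong (outside ∷_) (⊆∧∣≥∣⇒≡ p q (drop-∷-⊆ p⊆q) q≤p)
⊆∧∣≥∣⇒≡ (outside ∷ p) (inside ∷ q)  p⊆q q≤p = contradiction (p⊆q⇒∣p∣≤∣q∣ (drop-∷-⊆ p⊆q)) (<⇒≱ q≤p)
⊆∧∣≥∣⇒≡ (inside ∷ p)  (outside ∷ q) p⊆q q≤p with () ← p⊆q here
⊆∧∣≥∣⇒≡ (inside ∷ p)  (inside ∷ q)  p⊆q q≤p = cong (inside ∷_) (⊆∧∣≥∣⇒≡ p q (drop-∷-⊆ p⊆q) (≤-pred q≤p))

-- The number of maximal chains of the interval [∅, q] that pass through p.
chains : Subset n → Subset n → ℕ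
chains p q = if does (p ⊆? q) then ∣ p ∣ ! * (∣ q ∣ ∸ ∣ p ∣) ! else 0

chains-⊆ : {p q : Subset n} → p ⊆ q → chains p q ≡ ∣ p ∣ ! * (∣ q ∣ ∸ ∣ p ∣) !
chains-⊆ {p = p} {q} p⊆q rewrite dec-true (p ⊆? q) p⊆q = refl

lowerCovers : Subset n → List (Subset n)
lowerCovers []            = []
lowerCovers (outside ∷ p) = map (outside ∷_) (lowerCovers p)
lowerCovers (inside ∷ p)  = (outside ∷ p) ∷ map (inside ∷_) (lowerCovers p)

length-lowerCovers : (p : Subset n) → length (lowerCovers p) ≡ ∣ p ∣
length-lowerCovers []            = refl
length-lowerCovers (outside ∷ p) = trans (length-map _ (lowerCovers p)) (length-lowerCovers p)
length-lowerCovers (inside ∷ p)  = cong suc (trans (length-map _ (lowerCovers p)) (length-lowerCovers p))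

∣lowerCover∣ : (p : Subset n) {q : Subset n} → q ∈ₗ lowerCovers p → ∣ p ∣ ≡ suc ∣ q ∣
∣lowerCover∣ (outside ∷ p) q∈ with _ , q′∈ , refl ← ∈-map⁻ (outside ∷_) q∈ = ∣lowerCover∣ p q′∈
∣lowerCover∣ (inside ∷ p) (here refl) = refl
∣lowerCover∣ (inside ∷ p) (there q∈) with _ , q′∈ , refl ← ∈-map⁻ (inside ∷_) q∈ = cong suc (∣lowerCover∣ p q′∈)

-- A lower cover of `q` contains `p` exactly when the deleted element lies outside `p`, which leaves
-- `∣ q ∣ ∸ ∣ p ∣` choices. The Boolean hypothesis reduces along the head entries, so it passes to
-- the recursive call unchanged.
∣q∣≤∣p∣+covers : ∀ w (p q : Subset n) → does (p ⊆? q) ≡ true →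
  ∣ q ∣ * w ≤ ∣ p ∣ * w + ∑ (λ r → if does (p ⊆? r) then w else 0) (lowerCovers q)
∣q∣≤∣p∣+covers w [] [] p⊆q = z≤n
∣q∣≤∣p∣+covers w (outside ∷ p) (outside ∷ q) p⊆q
  rewrite sym (map-∘ {g = λ r → if does (outside ∷ p ⊆? r) then w else 0} {f = outside ∷_} (lowerCovers q)) =
  ∣q∣≤∣p∣+covers w p q p⊆q
∣q∣≤∣p∣+covers w (outside ∷ p) (inside ∷ q) p⊆q
  rewrite p⊆q | sym (map-∘ {g = λ r → if does (outside ∷ p ⊆? r) then w else 0} {f = inside ∷_} (lowerCovers q)) = begin
  w + ∣ q ∣ * w          ≤⟨ +-monoʳ-≤ w (∣q∣≤∣p∣+covers w p q p⊆q) ⟩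
  w + (∣ p ∣ * w + _)    ≡⟨ +-CS.x∙yz≈y∙xz w (∣ p ∣ * w) _ ⟩
  ∣ p ∣ * w + (w + _)    ∎
  where open ≤-Reasoning
∣q∣≤∣p∣+covers w (inside ∷ p) (inside ∷ q) p⊆q
  rewrite sym (map-∘ {g = λ r → if does (inside ∷ p ⊆? r) then w else 0} {f = inside ∷_} (lowerCovers q)) =
  ≤-trans (+-monoʳ-≤ w (∣q∣≤∣p∣+covers w p q p⊆q)) (≤-reflexive (sym (+-assoc w _ _)))

-- A maximal chain of [∅, `q`] through `p` ≠ `q` leaves `q` by a lower cover containing `p`. In
-- numbers: `∣ q ∣ ∸ ∣ p ∣` covers, each with `w` chains through `p`.
chains≤∑chains-lowerCovers : {p q : Subset n} → p ≢ q → chains p q ≤ ∑ (chains p) (lowerCovers q)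
chains≤∑chains-lowerCovers {p = p} {q} p≢q with p ⊆? q
... | no  p⊈q = z≤n
... | yes p⊆q = begin
  ∣ p ∣ ! * (∣ q ∣ ∸ ∣ p ∣) !                                    ≡⟨ cong (λ z → ∣ p ∣ ! * z !) q∸p≡ ⟩
  ∣ p ∣ ! * (suc j * j !)                                        ≡⟨ *-CS.x∙yz≈y∙xz (∣ p ∣ !) (suc j) (j !) ⟩
  suc j * w                                                      ≡⟨ cong (_* w) q∸p≡ ⟨
  (∣ q ∣ ∸ ∣ p ∣) * w                                            ≡⟨ *-distribʳ-∸ w ∣ q ∣ ∣ p ∣ ⟩
  ∣ q ∣ * w ∸ ∣ p ∣ * w                                          ≤⟨ m≤n+o⇒m∸n≤o _ (∣ p ∣ * w) (∣q∣≤∣p∣+covers w p q (dec-true (p ⊆? q) p⊆q)) ⟩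
  ∑ (λ r → if does (p ⊆? r) then w else 0) (lowerCovers q)       ≤⟨ ∑-mono (lowerCovers q) (λ r∈ → ≤-reflexive (onCover r∈)) ⟩
  ∑ (chains p) (lowerCovers q)                                   ∎
  where
  open ≤-Reasoning
  j = ∣ q ∣ ∸ suc ∣ p ∣
  w = ∣ p ∣ ! * j !
  q∸p≡ : ∣ q ∣ ∸ ∣ p ∣ ≡ suc j
  q∸p≡ = +-∸-assoc 1 (≰⇒> (λ q≤p → p≢q (⊆∧∣≥∣⇒≡ p q p⊆q q≤p)))
  onCover : ∀ {r} → r ∈ₗ lowerCovers q → (if does (p ⊆? r) then w else 0) ≡ chains p r
  onCover {r} r∈ = cong (λ z → if does (p ⊆? r) then ∣ p ∣ ! * (z ∸ suc ∣ p ∣) ! else 0) (∣lowerCover∣ q r∈)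

-- The chain count of a family satisfies a LYM-type inequality on every interval [∅, q] as soon as it does so for
-- q in the family: for other q each chain passes through a lower cover of q.
lym : ∀ α β (G : List (Subset n)) →
  (∀ {p} → p ∈ₗ G → α * ∑ (λ q → chains q p) G ≤ β * ∣ p ∣ !) →
  ∀ k q → ∣ q ∣ ≡ k → α * ∑ (λ p → chains p q) G ≤ β * k !
lym α β G local k q ∣q∣≡k with q ∈? G
  where open DecMembership _≟ₛ_
... | yes q∈G = subst (λ z → α * ∑ (λ p → chains p q) G ≤ β * z !) ∣q∣≡k (local q∈G)
... | no  q∉G = begin
  α * ∑ (λ p → chains p q) G                                    ≤⟨ *-monoʳ-≤ α (∑-mono G (λ {p} p∈G →
    chains≤∑chains-lowerCovers {p = p} {q} (λ { refl → q∉G p∈G }))) ⟩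
  α * ∑ (λ p → ∑ (chains p) (lowerCovers q)) G                  ≡⟨ cong (α *_) (∑-swap chains G (lowerCovers q)) ⟩
  α * ∑ (λ r → ∑ (λ p → chains p r) G) (lowerCovers q)          ≡⟨ ∑-*ˡ α _ (lowerCovers q) ⟨
  ∑ (λ r → α * ∑ (λ p → chains p r) G) (lowerCovers q)          ≤⟨ covers k ∣q∣≡k ⟩
  β * k !                                                       ∎
  where
  open ≤-Reasoning
  covers : ∀ k → ∣ q ∣ ≡ k → ∑ (λ r → α * ∑ (λ p → chains p r) G) (lowerCovers q) ≤ β * k !
  -- The empty set has no lower covers, so the sum is empty.
  covers zero    ∣q∣≡0 with [] ← lowerCovers q | refl ← trans (length-lowerCovers q) ∣q∣≡0 = z≤n
  covers (suc k) ∣q∣≡1+k = begin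
    ∑ (λ r → α * ∑ (λ p → chains p r) G) (lowerCovers q)        ≤⟨ ∑-mono (lowerCovers q) (λ {r} r∈ →
      lym α β G local k r (suc-injective (trans (sym (∣lowerCover∣ q r∈)) ∣q∣≡1+k))) ⟩
    ∑ (λ _ → β * k !) (lowerCovers q)                           ≡⟨ ∑-const (β * k !) (lowerCovers q) ⟩
    length (lowerCovers q) * (β * k !)                          ≡⟨ cong (_* (β * k !)) (trans (length-lowerCovers q) ∣q∣≡1+k) ⟩
    suc k * (β * k !)                                           ≡⟨ *-CS.x∙yz≈y∙xz (suc k) β (k !) ⟩
    β * (suc k * k !)                                           ∎

chains-⊤ : (p : Subset n) → chains p ⊤ ≡ ∣ p ∣ ! * (n ∸ ∣ p ∣) !
chains-⊤ {n} p = trans (chains-⊆ {p = p} ⊆⊤) (cong (λ z → ∣ p ∣ ! * (z ∸ ∣ p ∣) !) (∣⊤∣≡n n))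

-- Apply `lym` to the full set, where every member of `G` accounts for at least `n !` / `midBinom n`
-- chains.
lym-length : ∀ α β (G : List (Subset n)) →
  (∀ {p} → p ∈ₗ G → α * ∑ (λ q → chains q p) G ≤ β * ∣ p ∣ !) → α * length G ≤ β * midBinom n
lym-length {n} α β G local = *-cancelʳ-≤ (α * length G) (β * midBinom n) (n !) (begin
  α * length G * n !                             ≡⟨ *-assoc α (length G) (n !) ⟩
  α * (length G * n !)                           ≡⟨ cong (α *_) (∑-const (n !) G) ⟨
  α * ∑ (λ _ → n !) G                            ≤⟨ *-monoʳ-≤ α (∑-mono G (λ {p} _ →
    subst (λ z → n ! ≤ midBinom n * z) (sym (chains-⊤ p)) (n!≤midBinom*k!*[n∸k]! (∣p∣≤n p)))) ⟩
  α * ∑ (λ p → midBinom n * chains p ⊤) G        ≡⟨ cong (α *_) (∑-*ˡ (midBinom n) _ G) ⟩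
  α * (midBinom n * ∑ (λ p → chains p ⊤) G)      ≡⟨ *-CS.x∙yz≈y∙xz α (midBinom n) _ ⟩
  midBinom n * (α * ∑ (λ p → chains p ⊤) G)      ≤⟨ *-monoʳ-≤ (midBinom n) (lym α β G local n ⊤ (∣⊤∣≡n n)) ⟩
  midBinom n * (β * n !)                         ≡⟨ eq (midBinom n) β (n !) ⟩
  β * midBinom n * n !                           ∎)
  where
  open ≤-Reasoning
  instance _ = n !≢0
  eq : ∀ x y z → x * (y * z) ≡ y * x * z
  eq = solve-∀

-- Size bounds from counting chains

length≤1 : {A : Set} {x : A} (xs : List A) → Unique xs → (∀ {y} → y ∈ₗ xs → y ≡ x) → length xs ≤ 1
length≤1 []           _                     _  = z≤n
length≤1 (y ∷ [])     _                     _  = s≤s z≤n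
length≤1 (y ∷ z ∷ xs) ((y≢z ∷ _) ∷ _) h = contradiction (trans (h (here refl)) (sym (h (there (here refl))))) y≢z

-- Within one level the only member of `G` contained in `p` is `p` itself, so the local hypothesis
-- of `lym` holds with both constants 1, and each member uses `k ! * (n ∸ k) !` of the `n !` chains.
length-level≤C : ∀ {k} → k ≤ n → (G : List (Subset n)) → Unique G → (∀ {p} → p ∈ₗ G → ∣ p ∣ ≡ k) → length G ≤ n C k
length-level≤C {n} {k} k≤n G G! level = *-cancelʳ-≤ (length G) (n C k) (k ! * (n ∸ k) !) (begin
  length G * (k ! * (n ∸ k) !)          ≡⟨ ∑-const _ G ⟨
  ∑ (λ _ → k ! * (n ∸ k) !) G           ≤⟨ ∑-mono G (λ {p} p∈ →
    ≤-reflexive (sym (trans (chains-⊤ p) (cong (λ z → z ! * (n ∸ z) !) (level p∈))))) ⟩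
  ∑ (λ p → chains p ⊤) G                ≡⟨ *-identityˡ _ ⟨
  1 * ∑ (λ p → chains p ⊤) G            ≤⟨ lym 1 1 G local n ⊤ (∣⊤∣≡n n) ⟩
  1 * n !                               ≡⟨ *-identityˡ _ ⟩
  n !                                   ≡⟨ nCk*[k!*[n∸k]!]≡n! k≤n ⟨
  (n C k) * (k ! * (n ∸ k) !)           ∎)
  where
  open ≤-Reasoning
  instance _ = k !* (n ∸ k) !≢0
  local : ∀ {p} → p ∈ₗ G → 1 * ∑ (λ q → chains q p) G ≤ 1 * ∣ p ∣ !
  local {p} p∈ = *-monoʳ-≤ 1 (begin
    ∑ (λ q → chains q p) G                          ≤⟨ ∑-fibres (λ _ → _≟ₛ p) (λ q → chains q p) (λ _ → ∣ p ∣ !) 1 G only-p ⟩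
    length (filter (_≟ₛ p) G) * ∣ p ∣ !             ≤⟨ *-monoˡ-≤ (∣ p ∣ !)
      (length≤1 _ (Unique.filter⁺ (_≟ₛ p) G!) (proj₂ ∘ ∈-filter⁻ (_≟ₛ p) {xs = G})) ⟩
    1 * ∣ p ∣ !                                     ≡⟨ *-identityˡ _ ⟩
    ∣ p ∣ !                                         ∎)
    where
    only-p : ∀ {q} → q ∈ₗ G → chains q p ≡ 0 ⊎ ∃ λ j → j < 1 × q ≡ p × chains q p ≤ ∣ p ∣ !
    only-p {q} q∈ with q ⊆? p
    ... | no  _   = inj₁ refl
    ... | yes q⊆p = inj₂ (0 , s≤s z≤n , q≡p , ≤-reflexive (trans
      (cong₂ (λ x y → x ! * y !) (cong ∣_∣ q≡p) (trans (cong (∣ p ∣ ∸_) (cong ∣_∣ q≡p)) (n∸n≡0 ∣ p ∣))) (*-identityʳ _)))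
      where q≡p = ⊆∧∣≥∣⇒≡ q p q⊆p (≤-reflexive (trans (level p∈) (sym (level q∈))))

-- Sort `G` by size: the levels below `r` have at most `∑< r (n C_)` sets in all, and geometric
-- growth bounds this by `n C r` divided by `d`.
length-small≤ : ∀ d r → (2 + d) * r ≤ n → (G : List (Subset n)) → Unique G → (∀ {p} → p ∈ₗ G → ∣ p ∣ < r) →
  d * length G ≤ midBinom n
length-small≤ {n} d r [2+d]r≤n G G! small = begin
  d * length G                                        ≡⟨ cong (d *_) (trans (∑-const 1 G) (*-identityʳ _)) ⟨
  d * ∑ (λ _ → 1) G                                   ≤⟨ *-monoʳ-≤ d (∑-fibres level? (λ _ → 1) (λ _ → 1) r G (λ p∈ → inj₂ (_ , small p∈ , refl , ≤-refl))) ⟩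
  d * ∑< r (λ k → length (filter (level? k) G) * 1)   ≤⟨ *-monoʳ-≤ d (∑<-mono r (λ {k} k<r → ≤-trans (≤-reflexive (*-identityʳ _))
    (length-level≤C (<⇒≤ (<-≤-trans k<r r≤n)) _ (Unique.filter⁺ (level? k) G!) (proj₂ ∘ ∈-filter⁻ (level? k) {xs = G})))) ⟩
  d * ∑< r (n C_)                                     ≤⟨ d*∑C≤C d r [2+d]r≤n ⟩
  n C r                                               ≤⟨ nCk≤midBinom r≤n ⟩
  midBinom n                                          ∎
  where
  open ≤-Reasoning
  level? : ∀ k → Decidable (λ (p : Subset n) → ∣ p ∣ ≡ k)
  level? k p = ∣ p ∣ ≟ k
  r≤n : r ≤ n
  r≤n = ≤-trans (m≤m+n r _) [2+d]r≤n

Below : Subset n → ℕ → Subset n → Set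
Below p k q = q ⊆ p × ∣ q ∣ ≡ k

below? : ∀ (p : Subset n) k → Decidable (Below p k)
below? p k q = (q ⊆? p) ×-dec (∣ q ∣ ≟ k)

-- The set `p` itself contributes `∣ p ∣ !` chains of [∅, `p`]. The members strictly below it
-- contribute at most `4 * N * (∣ p ∣ ∸ 1) !`, which is at most `∣ p ∣ !` / `d` because
-- `4 * d * N ≤ r ≤ ∣ p ∣`.
length-poor≤ : ∀ d r N → 1 ≤ r → 4 * d * N ≤ r → (G : List (Subset n)) → Unique G →
  (∀ {p} → p ∈ₗ G → r ≤ ∣ p ∣) →
  (∀ {p k} → p ∈ₗ G → k < ∣ p ∣ → length (filter (below? p k) G) ≤ N) →
  d * length G ≤ (1 + d) * midBinom n
length-poor≤ {n} d r N 1≤r 4dN≤r G G! large poor = lym-length d (1 + d) G (λ {p} p∈ → local p p∈ _ refl)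
  where
  open ≤-Reasoning
  local : ∀ p → p ∈ₗ G → ∀ k → k ≡ ∣ p ∣ → d * ∑ (λ q → chains q p) G ≤ (1 + d) * ∣ p ∣ !
  local p p∈ zero    0≡   = contradiction (≤-trans 1≤r (≤-trans (large p∈) (≤-reflexive (sym 0≡)))) λ ()
  local p p∈ (suc m) 1+m≡ = begin
    d * ∑ (λ q → chains q p) G                    ≤⟨ *-monoʳ-≤ d (∑-fibres (below? p ∘ suc) (λ q → chains q p) φ (suc m) G fibre) ⟩
    d * (∑< m (λ k → length (level k) * φ k) + length (level m) * φ m)
                                                  ≤⟨ *-monoʳ-≤ d (+-mono-≤ lower top) ⟩
    d * (N * (4 * m !) + (suc m) !)               ≡⟨ eq d N (m !) ((suc m) !) ⟩
    4 * d * N * m ! + d * (suc m) !               ≤⟨ +-monoˡ-≤ _ (*-monoˡ-≤ (m !) (≤-trans 4dN≤r (≤-trans (large p∈) (≤-reflexive (sym 1+m≡))))) ⟩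
    (1 + d) * (suc m) !                           ≡⟨ cong (λ z → (1 + d) * z !) 1+m≡ ⟩
    (1 + d) * ∣ p ∣ !                             ∎
    where
    -- Index `k` stands for size `k + 1`, since members of `G` are nonempty by `1 ≤ r`. As `∣ p ∣`
    -- is `m + 1`, index `m` is the level of `p` and holds `p` alone.
    φ : ℕ → ℕ
    φ k = (suc k) ! * (m ∸ k) !
    level : ℕ → List (Subset n)
    level k = filter (below? p (suc k)) G
    eq : ∀ d N x y → d * (N * (4 * x) + y) ≡ 4 * d * N * x + d * y
    eq = solve-∀
    fibre : ∀ {q} → q ∈ₗ G → chains q p ≡ 0 ⊎ ∃ λ k → k < suc m × Below p (suc k) q × chains q p ≤ φ k
    fibre {q} q∈ with q ⊆? p
    ... | no  _   = inj₁ refl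
    ... | yes q⊆p = go _ refl
      where
      go : ∀ l → l ≡ ∣ q ∣ →
        (∣ q ∣ ! * (∣ p ∣ ∸ ∣ q ∣) ! ≡ 0) ⊎ ∃ λ k → k < suc m × Below p (suc k) q × ∣ q ∣ ! * (∣ p ∣ ∸ ∣ q ∣) ! ≤ φ k
      go zero    0≡   = contradiction (≤-trans 1≤r (≤-trans (large q∈) (≤-reflexive (sym 0≡)))) λ ()
      go (suc k) 1+k≡ = inj₂ (k , subst₂ _≤_ (sym 1+k≡) (sym 1+m≡) (p⊆q⇒∣p∣≤∣q∣ q⊆p) , ((λ {x} → q⊆p {x}) , sym 1+k≡)
        , ≤-reflexive (cong₂ (λ x y → x ! * (y ∸ x) !) (sym 1+k≡) (sym 1+m≡)))
    lower : ∑< m (λ k → length (level k) * φ k) ≤ N * (4 * m !)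
    lower = begin
      ∑< m (λ k → length (level k) * φ k)   ≤⟨ ∑<-mono m (λ {k} k<m → *-monoˡ-≤ (φ k) (poor p∈ (subst (suc k <_) 1+m≡ (s≤s k<m)))) ⟩
      ∑< m (λ k → N * φ k)                  ≡⟨ ∑<-*ˡ N φ m ⟩
      N * ∑< m φ                            ≤⟨ *-monoʳ-≤ N (∑[1+k]!*[q∸k]!≤4*q! m) ⟩
      N * (4 * m !)                         ∎
    top : length (level m) * φ m ≤ (suc m) !
    top = begin
      length (level m) * φ m                ≤⟨ *-monoˡ-≤ (φ m) (length≤1 (level m) (Unique.filter⁺ (below? p (suc m)) G!) is-p) ⟩
      1 * φ m                               ≡⟨ *-identityˡ _ ⟩
      (suc m) ! * (m ∸ m) !                 ≡⟨ cong (λ z → (suc m) ! * z !) (n∸n≡0 m) ⟩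
      (suc m) ! * 1                         ≡⟨ *-identityʳ _ ⟩
      (suc m) !                             ∎
      where
      is-p : ∀ {q} → q ∈ₗ level m → q ≡ p
      is-p {q} q∈ with _ , q⊆p , ∣q∣≡ ← ∈-filter⁻ (below? p (suc m)) {xs = G} q∈ =
        ⊆∧∣≥∣⇒≡ q p q⊆p (≤-reflexive (trans (sym 1+m≡) (sym ∣q∣≡)))

-- Rich sets

lookup-injective : {xs : List A} → Unique xs → ∀ i j → lookup xs i ≡ lookup xs j → i ≡ j
lookup-injective (_   ∷ _)   zero    zero    _  = refl
lookup-injective (x∉ ∷ _)   zero    (suc j) eq = contradiction eq (All.lookup x∉ (∈-lookup j))
lookup-injective (x∉ ∷ _)   (suc i) zero    eq = contradiction (sym eq) (All.lookup x∉ (∈-lookup i))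
lookup-injective (_   ∷ xs!) (suc i) (suc j) eq = cong suc (lookup-injective xs! i j eq)

length-filter-∪ : {P Q R : A → Set} (P? : Decidable P) (Q? : Decidable Q) (R? : Decidable R) →
  (∀ {x} → P x → Q x ⊎ R x) → ∀ xs →
  length (filter P? xs) ≤ length (filter Q? xs) + length (filter R? xs)
length-filter-∪ P? Q? R? P⊆Q∪R []       = z≤n
length-filter-∪ P? Q? R? P⊆Q∪R (x ∷ xs) with P? x | Q? x | R? x | length-filter-∪ P? Q? R? P⊆Q∪R xs
... | no  _ | no  _ | no  _ | ih = ih
... | no  _ | no  _ | yes _ | ih = ≤-trans ih (+-monoʳ-≤ _ (n≤1+n _))
... | no  _ | yes _ | no  _ | ih = m≤n⇒m≤1+n ih
... | no  _ | yes _ | yes _ | ih = m≤n⇒m≤1+n (≤-trans ih (+-monoʳ-≤ _ (n≤1+n _)))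
... | yes p | no ¬q | no ¬r | ih = contradiction (P⊆Q∪R p) λ { (inj₁ q) → ¬q q ; (inj₂ r) → ¬r r }
... | yes _ | no  _ | yes _ | ih = ≤-trans (s≤s ih) (≤-reflexive (sym (+-suc _ _)))
... | yes _ | yes _ | no  _ | ih = s≤s ih
... | yes _ | yes _ | yes _ | ih = s≤s (≤-trans ih (+-monoʳ-≤ _ (n≤1+n _)))

length-filter-map : {P : B → Set} (P? : Decidable P) (f : A → B) → ∀ xs →
  length (filter P? (map f xs)) ≡ length (filter (P? ∘ f) xs)
length-filter-map P? f []       = refl
length-filter-map P? f (x ∷ xs) with P? (f x)
... | yes _ = cong suc (length-filter-map P? f xs)
... | no  _ = length-filter-map P? f xs

∁-involutive : (p : Subset n) → ∁ (∁ p) ≡ p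
∁-involutive p = trans (sym (Vec.map-∘ _ _ p)) (trans (Vec.map-cong Bool.not-involutive p) (Vec.map-id p))

∁-injective : {p q : Subset n} → ∁ p ≡ ∁ q → p ≡ q
∁-injective {p = p} {q} eq = trans (sym (∁-involutive p)) (trans (cong ∁ eq) (∁-involutive q))

-- The witnesses are taken from a single level so that they form an antichain, and from a level
-- under that of `p` so that they are proper subsets.
DenseBelow : List (Subset n) → ℕ → Subset n → Set
DenseBelow F N p = ∃ λ k → k < ∣ p ∣ × N ≤ length (filter (below? p k) F)

Rich : List (Subset n) → ℕ → ℕ → Subset n → Set
Rich F r N p = r ≤ ∣ p ∣ × DenseBelow F N p

denseBelow? : (F : List (Subset n)) (N : ℕ) → Decidable (DenseBelow F N)
denseBelow? F N p = anyUpTo? (λ k → N ≤? length (filter (below? p k) F)) ∣ p ∣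

rich? : (F : List (Subset n)) (r N : ℕ) → Decidable (Rich F r N)
rich? F r N p = (r ≤? ∣ p ∣) ×-dec denseBelow? F N p

-- A set that is not rich is either small or large without a dense level below it. These two cases
-- contribute 1 and `1 + d` to the constant `2 + d`.
length-¬rich≤ : ∀ d r N → 1 ≤ r → 4 * d * N ≤ r → (2 + d) * r ≤ n → (F : List (Subset n)) → Unique F →
  d * length (filter (¬? ∘ rich? F r N) F) ≤ (2 + d) * midBinom n
length-¬rich≤ {n} d r N 1≤r 4dN≤r [2+d]r≤n F F! = begin
  d * length (filter (¬? ∘ rich? F r N) F)               ≤⟨ *-monoʳ-≤ d (length-filter-∪ (¬? ∘ rich? F r N) small? poor? split F) ⟩
  d * (length (filter small? F) + length G)              ≡⟨ *-distribˡ-+ d (length (filter small? F)) _ ⟩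
  d * length (filter small? F) + d * length G            ≤⟨ +-mono-≤
    (length-small≤ d r [2+d]r≤n _ (Unique.filter⁺ small? F!) (proj₂ ∘ ∈-filter⁻ small? {xs = F}))
    (length-poor≤ d r N 1≤r 4dN≤r G (Unique.filter⁺ poor? F!) (proj₁ ∘ poor) fewBelow) ⟩
  (2 + d) * midBinom n                                   ∎
  where
  open ≤-Reasoning
  small? : Decidable (λ (p : Subset n) → ∣ p ∣ < r)
  small? p = ∣ p ∣ <? r
  poor? : Decidable (λ (p : Subset n) → r ≤ ∣ p ∣ × ¬ DenseBelow F N p)
  poor? p = (r ≤? ∣ p ∣) ×-dec ¬? (denseBelow? F N p)
  G = filter poor? F
  poor : ∀ {p} → p ∈ₗ G → r ≤ ∣ p ∣ × ¬ DenseBelow F N p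
  poor p∈ = proj₂ (∈-filter⁻ poor? {xs = F} p∈)
  split : ∀ {p} → ¬ Rich F r N p → ∣ p ∣ < r ⊎ (r ≤ ∣ p ∣ × ¬ DenseBelow F N p)
  split {p} ¬rich with r ≤? ∣ p ∣
  ... | yes r≤ = inj₂ (r≤ , λ dense → ¬rich (r≤ , dense))
  ... | no  r≰ = inj₁ (≰⇒> r≰)
  -- Density is measured in `F`, but the bound passes to the sublist `G`.
  fewBelow : ∀ {p k} → p ∈ₗ G → k < ∣ p ∣ → length (filter (below? p k) G) ≤ N
  fewBelow {p} {k} p∈ k<p = ≤-trans
    (length-mono-≤ (filter⁺ (below? p k) (below? p k) (λ { refl q → q }) (filter-⊆ poor? F)))
    (<⇒≤ (≰⇒> λ N≤ → proj₂ (poor p∈) (k , k<p , N≤)))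

-- Fans and the induced copies they span

record Fan (_≼_ : Subset n → Subset n → Set) (N : ℕ) (F : List (Subset n)) (p : Subset n) : Set where
  field
    fan       : Fin N → Subset n
    fan∈      : ∀ i → fan i ∈ₗ F
    fan≼      : ∀ i → fan i ≼ p
    fan⋡      : ∀ i → ¬ p ≼ fan i
    antichain : ∀ i j → fan i ≼ fan j → i ≡ j

open Fan

-- Taking the order as a parameter lets both kinds share one definition. Since inclusion is
-- reflexive, `antichain` also makes the sets of a fan distinct.
LowerFan UpperFan : ℕ → List (Subset n) → Subset n → Set
LowerFan = Fan (λ p q → p ⊆ q)
UpperFan = Fan (λ p q → q ⊆ p)

restrict : ∀ {_≼_ : Subset n → Subset n → Set} {F p} → N′ ≤ N → Fan _≼_ N F p → Fan _≼_ N′ F p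
restrict N′≤N L = record
  { fan       = λ i → fan L (inject≤ i N′≤N)
  ; fan∈      = λ i → fan∈ L (inject≤ i N′≤N)
  ; fan≼      = λ i → fan≼ L (inject≤ i N′≤N)
  ; fan⋡      = λ i → fan⋡ L (inject≤ i N′≤N)
  ; antichain = λ i j i≼j → inject≤-injective N′≤N N′≤N i j (antichain L _ _ i≼j)
  }

-- Sets of equal size are comparable only if equal, and a size smaller than `∣ p ∣` rules out
-- containing `p`.
rich⇒lowerFan : ∀ {F r} {p : Subset n} → Unique F → Rich F r N p → LowerFan N F p
rich⇒lowerFan {F = F} {p = p} F! (_ , k , k<∣p∣ , N≤) = restrict N≤ (record
  { fan       = lookup L
  ; fan∈      = proj₁ ∘ level
  ; fan≼      = λ i → proj₁ (proj₂ (level i))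
  ; fan⋡      = λ i p⊆ → <⇒≱ k<∣p∣ (≤-trans (p⊆q⇒∣p∣≤∣q∣ p⊆) (≤-reflexive (size i)))
  ; antichain = λ i j i⊆j → lookup-injective (Unique.filter⁺ (below? p k) F!) i j
      (⊆∧∣≥∣⇒≡ _ _ i⊆j (≤-reflexive (trans (size j) (sym (size i)))))
  })
  where
  L = filter (below? p k) F
  level : ∀ i → lookup L i ∈ₗ F × Below p k (lookup L i)
  level i = ∈-filter⁻ (below? p k) {xs = F} (∈-lookup i)
  size : ∀ i → ∣ lookup L i ∣ ≡ k
  size i = proj₂ (proj₂ (level i))

-- Complementation reverses inclusion, so richness of `∁ p` among the complements supplies the sets
-- above `p`.
∁-lowerFan : ∀ {F} {p : Subset n} → LowerFan N (map ∁ F) (∁ p) → UpperFan N F p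
∁-lowerFan {F = F} {p} L = record
  { fan       = ∁ ∘ fan L
  ; fan∈      = in-F
  ; fan≼      = λ i → ∁p⊆∁q⇒p⊇q (λ x → fan≼ L i (⊆-reflexive (∁-involutive (fan L i)) x))
  ; fan⋡      = λ i ∁⊆p → fan⋡ L i (λ x → ⊆-reflexive (∁-involutive (fan L i)) (p⊆q⇒∁p⊇∁q ∁⊆p x))
  ; antichain = λ i j ∁⊆∁ → antichain L i j (∁p⊆∁q⇒p⊇q ∁⊆∁)
  }
  where
  in-F : ∀ i → ∁ (fan L i) ∈ₗ F
  in-F i with q , q∈F , eq ← ∈-map⁻ ∁ (fan∈ L i) = subst (_∈ₗ F) (sym (trans (cong ∁ eq) (∁-involutive q))) q∈F

-- Each fan is cut into blocks of M sets, and a copy takes one set from each block; this makes distinct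
-- choices yield distinct subfamilies.
copy : ∀ {s t M F} {p : Subset n} → p ∈ₗ F → LowerFan (s * M) F p → UpperFan (t * M) F p →
  (Fin s → Fin M) → (Fin t → Fin M) → InducedCopy s t n F
copy {s = s} {t} {F = F} {p} p∈F L U f g = record { emb = e ; inFamily = mem ; induced = ind }
  where
  e : KElem s t → Subset _
  e (a j) = fan L (combine j (f j))
  e b     = p
  e (c k) = fan U (combine k (g k))

  mem : ∀ x → e x ∈ₗ F
  mem (a j) = fan∈ L _
  mem b     = p∈F
  mem (c k) = fan∈ U _

  ind : ∀ x y → (x ≤K y → e x ⊆ e y) × (e x ⊆ e y → x ≤K y)
  ind (a i) (a j) = (λ { a≤a x → x }) , λ i⊆j → subst (λ z → a i ≤K a z)
    (combine-injectiveˡ i (f i) j (f j) (antichain L _ _ i⊆j)) a≤a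
  ind (a i) b     = (λ { a≤b → fan≼ L _ }) , λ _ → a≤b
  ind (a i) (c k) = (λ { a≤c → ⊆-trans (fan≼ L _) (fan≼ U _) }) , λ _ → a≤c
  ind b     (a j) = (λ ()) , λ p⊆ → ⊥-elim (fan⋡ L _ p⊆)
  ind b     b     = (λ { b≤b x → x }) , λ _ → b≤b
  ind b     (c k) = (λ { b≤c → fan≼ U _ }) , λ _ → b≤c
  ind (c k) (a j) = (λ ()) , λ c⊆a → ⊥-elim (fan⋡ U _ (⊆-trans c⊆a (fan≼ L _)))
  ind (c k) b     = (λ ()) , λ c⊆p → ⊥-elim (fan⋡ U _ c⊆p)
  ind (c k) (c l) = (λ { c≤c x → x }) , λ k⊆l → subst (λ z → c z ≤K c l)
    (combine-injectiveˡ l (g l) k (g k) (antichain U _ _ k⊆l)) c≤c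

-- Distinctness and number of the copies

emb-reflects : ∀ {s t F} (G : InducedCopy s t n F) {x y} → emb G x ≡ emb G y → x ≤K y
emb-reflects G {x} {y} eq = proj₂ (induced G x y) (⊆-reflexive eq)

-- Suppose the middle set of `G` were the minimal set `a j` of `H`. The set of `G` at `a j` lies
-- properly inside it and is also a member of `H`, against minimality. The case of `c k` is dual.
same⇒≡b : ∀ {s t F} (G H : InducedCopy s t n F) → SameSubfamily G H → emb G b ≡ emb H b
same⇒≡b G H (G⇒H , _) with G⇒H b
... | b   , eq = eq
... | a j , eq = ⊥-elim (case-a (G⇒H (a j)))
  where
  case-a : (∃ λ q → emb G (a j) ≡ emb H q) → ⊥
  case-a (q , eq′) = below q eq′ (proj₂ (induced H q (a j)) q⊆a)
    where
    q⊆a : emb H q ⊆ emb H (a j)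
    q⊆a x∈ = ⊆-reflexive eq (proj₁ (induced G (a j) b) a≤b (⊆-reflexive (sym eq′) x∈))
    below : ∀ q → emb G (a j) ≡ emb H q → q ≤K a j → ⊥
    below (a j) eq′ a≤a with () ← emb-reflects G (trans eq (sym eq′))
... | c k , eq = ⊥-elim (case-c (G⇒H (c k)))
  where
  case-c : (∃ λ q → emb G (c k) ≡ emb H q) → ⊥
  case-c (q , eq′) = above q eq′ (proj₂ (induced H (c k) q) c⊆q)
    where
    c⊆q : emb H (c k) ⊆ emb H q
    c⊆q x∈ = ⊆-reflexive eq′ (proj₁ (induced G b (c k)) b≤c (⊆-reflexive (sym eq) x∈))
    above : ∀ q → emb G (c k) ≡ emb H q → c k ≤K q → ⊥
    above (c k) eq′ c≤c with () ← emb-reflects G (trans eq′ (sym eq))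

-- A lower set of one copy can only equal a lower set of the other, as fans lie strictly on their
-- side of `p`. Its position in the fan then determines both the block and the choice made in it.
copy-injective : ∀ {s t M F} {p : Subset n} {p∈F : p ∈ₗ F} (L : LowerFan (s * M) F p) (U : UpperFan (t * M) F p) {f f′ g g′} →
  SameSubfamily (copy p∈F L U f g) (copy p∈F L U f′ g′) → f ≗ f′ × g ≗ g′
copy-injective {s = s} {t} {M} {F} {p} {p∈F} L U {f} {f′} {g} {g′} (G⇒H , _) =
  (λ j → lower j (G⇒H (a j))) , (λ k → upper k (G⇒H (c k)))
  where
  H = copy {s = s} {t} {M} p∈F L U f′ g′
  lower : ∀ j → (∃ λ q → fan L (combine j (f j)) ≡ emb H q) → f j ≡ f′ j
  lower j (a j′ , eq) with refl , fj≡ ← combine-injective j (f j) j′ (f′ j′) (antichain L _ _ (⊆-reflexive eq)) = fj≡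
  lower j (b    , eq) = ⊥-elim (fan⋡ L _ (⊆-reflexive (sym eq)))
  lower j (c k  , eq) = ⊥-elim (fan⋡ U _ (λ x → fan≼ L _ (⊆-reflexive (sym eq) x)))
  upper : ∀ k → (∃ λ q → fan U (combine k (g k)) ≡ emb H q) → g k ≡ g′ k
  upper k (a j  , eq) = ⊥-elim (fan⋡ L _ (λ x → ⊆-reflexive eq (fan≼ U _ x)))
  upper k (b    , eq) = ⊥-elim (fan⋡ U _ (⊆-reflexive eq))
  upper k (c k′ , eq) with refl , gk≡ ← combine-injective k (g k) k′ (g′ k′) (antichain U _ _ (⊆-reflexive (sym eq))) = gk≡

funToFin-cong : ∀ {k M} {f g : Fin k → Fin M} → f ≗ g → funToFin f ≡ funToFin g
funToFin-cong {zero}  f≗g = refl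
funToFin-cong {suc k} f≗g = cong₂ combine (f≗g zero) (funToFin-cong (f≗g ∘ suc))

finToFun-injective : ∀ {k M} (i j : Fin (M ^ k)) → finToFun {M} {k} i ≗ finToFun {M} {k} j → i ≡ j
finToFun-injective {k} {M} i j eq = trans (sym (funToFin-finToFin {k} {M} i)) (trans (funToFin-cong eq) (funToFin-finToFin {k} {M} j))

remQuot-injective : ∀ {m} k (i j : Fin (m * k)) → remQuot {m} k i ≡ remQuot {m} k j → i ≡ j
remQuot-injective {m} k i j eq = trans (sym (combine-remQuot {m} k i)) (trans (cong (uncurry combine) eq) (combine-remQuot {m} k j))

-- Copies are indexed by a member of `D` and two choice functions, encoded as numbers below `M ^ s`
-- and `M ^ t`. The middle set recovers the first component, and `copy-injective` the other two.
fans⇒copies : ∀ {s t M} {F D : List (Subset n)} → Unique D → (∀ {p} → p ∈ₗ D → p ∈ₗ F) →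
  (∀ {p} → p ∈ₗ D → LowerFan (s * M) F p) → (∀ {p} → p ∈ₗ D → UpperFan (t * M) F p) →
  Σ (List (InducedCopy s t n F)) λ copies →
    AllPairs DistinctCopies copies × length copies ≡ length D * (M ^ s * M ^ t)
fans⇒copies {n} {s} {t} {M} {F} {D} D! D⊆F L U =
  tabulate (at ∘ decode) ,
  AllPairs.tabulate⁺ (λ {i} {j} i≢j same → i≢j (decode-injective i j (at-injective (decode i) (decode j) same))) ,
  length-tabulate (at ∘ decode)
  where
  Index : Set
  Index = Fin (length D) × Fin (M ^ s) × Fin (M ^ t)

  decode : Fin (length D * (M ^ s * M ^ t)) → Index
  decode i = let x , yz = remQuot {length D} (M ^ s * M ^ t) i in x , remQuot {M ^ s} (M ^ t) yz

  decode-injective : ∀ i j → decode i ≡ decode j → i ≡ j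
  decode-injective i j eq = remQuot-injective {length D} (M ^ s * M ^ t) i j
    (cong₂ _,_ (cong proj₁ eq) (remQuot-injective {M ^ s} (M ^ t) _ _ (cong proj₂ eq)))

  at : Index → InducedCopy s t n F
  at (x , y , z) = copy (D⊆F (∈-lookup x)) (L (∈-lookup x)) (U (∈-lookup x)) (finToFun {M} {s} y) (finToFun {M} {t} z)

  at-injective : ∀ i j → SameSubfamily (at i) (at j) → i ≡ j
  at-injective i@(x , y , z) j@(x′ , y′ , z′) same with lookup-injective D! x x′ (same⇒≡b (at i) (at j) same)
  ... | refl with f≗f′ , g≗g′ ← copy-injective {p∈F = D⊆F (∈-lookup x)} (L (∈-lookup x)) (U (∈-lookup x)) same =
    cong (x ,_) (cong₂ _,_ (finToFun-injective {s} {M} y y′ f≗f′) (finToFun-injective {t} {M} z z′ g≗g′))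

-- Supersaturation in natural numbers

^-distribʳ-* : ∀ k m n → (m * n) ^ k ≡ m ^ k * n ^ k
^-distribʳ-* zero    m n = refl
^-distribʳ-* (suc k) m n = trans (cong (m * n *_) (^-distribʳ-* k m n)) (*-CS.interchange m n (m ^ k) (n ^ k))

-- At most `(2 + d) * midBinom n` / `d` members fail to be rich below, and as many fail above. Since
-- 5 + 2d = 1 + 2(2 + d), at least `midBinom n` / `d` members are rich on both sides, and each is
-- the middle of `M ^ (s + t)` copies.
supersaturation : ∀ s t d r M → 1 ≤ r → 4 * d * ((s + t) * M) ≤ r → (2 + d) * r ≤ n →
  (F : List (Subset n)) → Unique F → (5 + 2 * d) * midBinom n ≤ d * length F →
  Σ (List (InducedCopy s t n F)) λ copies →
    AllPairs DistinctCopies copies × midBinom n * M ^ (s + t) ≤ d * length copies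
supersaturation {n} s t d r M 1≤r 4dN≤r [2+d]r≤n F F! large =
  proj₁ copies , proj₁ (proj₂ copies) , (begin
    m * M ^ (s + t)                           ≤⟨ *-monoˡ-≤ (M ^ (s + t)) manyGood ⟩
    d * length D * M ^ (s + t)                ≡⟨ *-assoc d _ _ ⟩
    d * (length D * M ^ (s + t))              ≡⟨ cong (λ z → d * (length D * z)) (^-distribˡ-+-* M s t) ⟩
    d * (length D * (M ^ s * M ^ t))          ≡⟨ cong (d *_) (proj₂ (proj₂ copies)) ⟨
    d * length (proj₁ copies)                 ∎)
  where
  open ≤-Reasoning
  m = midBinom n
  -- At least both `s * M` and `t * M`, so one threshold serves both fans.
  width = (s + t) * M
  F∁ = map ∁ F
  F∁! : Unique F∁
  F∁! = Unique.map⁺ ∁-injective F!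
  richBelow? : Decidable (Rich F r width)
  richBelow? = rich? F r width
  richAbove? : Decidable (Rich F∁ r width ∘ ∁)
  richAbove? = rich? F∁ r width ∘ ∁
  good? : Decidable (λ p → Rich F r width p × Rich F∁ r width (∁ p))
  good? p = richBelow? p ×-dec richAbove? p
  D = filter good? F
  good : ∀ {p} → p ∈ₗ D → p ∈ₗ F × Rich F r width p × Rich F∁ r width (∁ p)
  good = ∈-filter⁻ good? {xs = F}
  copies = fans⇒copies {s = s} {t} {M} (Unique.filter⁺ good? F!) (proj₁ ∘ good)
    (λ p∈ → restrict (*-monoˡ-≤ M (m≤m+n s t)) (rich⇒lowerFan F! (proj₁ (proj₂ (good p∈)))))
    (λ p∈ → restrict (*-monoˡ-≤ M (m≤n+m t s)) (∁-lowerFan (rich⇒lowerFan F∁! (proj₂ (proj₂ (good p∈))))))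
  badBelow badAbove : ℕ
  badBelow = length (filter (¬? ∘ richBelow?) F)
  badAbove = length (filter (¬? ∘ richAbove?) F)
  cover : length F ≤ length D + (badBelow + badAbove)
  cover = begin
    length F                                               ≡⟨ cong length (filter-all U? (All.universal (λ _ → _) F)) ⟨
    length (filter U? F)                                   ≤⟨ length-filter-∪ U? good? (¬? ∘ good?) (λ {p} _ → toSum (good? p)) F ⟩
    length D + length (filter (¬? ∘ good?) F)              ≤⟨ +-monoʳ-≤ (length D)
      (length-filter-∪ (¬? ∘ good?) (¬? ∘ richBelow?) (¬? ∘ richAbove?) split F) ⟩
    length D + (badBelow + badAbove)                       ∎
    where
    split : ∀ {p} → ¬ (Rich F r width p × Rich F∁ r width (∁ p)) → ¬ Rich F r width p ⊎ ¬ Rich F∁ r width (∁ p)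
    split {p} ¬good with richBelow? p
    ... | yes below = inj₂ (λ above → ¬good (below , above))
    ... | no ¬below = inj₁ ¬below
  manyGood : m ≤ d * length D
  manyGood = +-cancelʳ-≤ ((2 + d) * m + (2 + d) * m) m (d * length D) (begin
    m + ((2 + d) * m + (2 + d) * m)                        ≡⟨ eq m d ⟩
    (5 + 2 * d) * m                                        ≤⟨ large ⟩
    d * length F                                           ≤⟨ *-monoʳ-≤ d cover ⟩
    d * (length D + (badBelow + badAbove))                 ≡⟨ *-distribˡ-+ d (length D) _ ⟩
    d * length D + d * (badBelow + badAbove)               ≡⟨ cong (d * length D +_) (*-distribˡ-+ d badBelow badAbove) ⟩
    d * length D + (d * badBelow + d * badAbove)           ≤⟨ +-monoʳ-≤ (d * length D) (+-mono-≤
      (length-¬rich≤ d r width 1≤r 4dN≤r [2+d]r≤n F F!)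
      (subst (λ z → d * z ≤ (2 + d) * m) (length-filter-map (¬? ∘ rich? F∁ r width) ∁ F)
        (length-¬rich≤ d r width 1≤r 4dN≤r [2+d]r≤n F∁ F∁!))) ⟩
    d * length D + ((2 + d) * m + (2 + d) * m)             ∎)
    where
    eq : ∀ m d → m + ((2 + d) * m + (2 + d) * m) ≡ (5 + 2 * d) * m
    eq = solve-∀

-- Passage to the rationals

open import Data.Integer using (+_; -[1+_]; +<+; +≤+)

toℚᵘ-ℕ : ∀ m → toℚᵘ (ℕ→ℚ m) ≃ mkℚᵘ (+ m) 0
toℚᵘ-ℕ m = ℚ.toℚᵘ-fromℚᵘ (mkℚᵘ (+ m) 0)

-- A positive `ε` has numerator at least 1, so it may be replaced by the reciprocal of its
-- denominator before clearing denominators.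
size-bound : ∀ {m l} (ε : ℚ) → 0ℚ <ℚ ε → (ℕ→ℚ 2 +ℚ ε) *ℚ ℕ→ℚ m ≤ℚ ℕ→ℚ l →
  (2 * ↧ₙ ε + 1) * m ≤ ↧ₙ ε * l
size-bound         (mkℚ (+ 0) _ _)           (*<*ℚ (+<+ ()))
size-bound         (mkℚ -[1+ _ ] _ _)        (*<*ℚ ())
size-bound {m} {l} ε@(mkℚ (+ suc p) e _) _ le with ℚᵘ.≤-respˡ-≃ lhs (ℚᵘ.≤-respʳ-≃ (toℚᵘ-ℕ l) (ℚ.toℚᵘ-mono-≤ le))
  where
  lhs : toℚᵘ ((ℕ→ℚ 2 +ℚ ε) *ℚ ℕ→ℚ m) ≃ (mkℚᵘ (+ 2) 0 ℚᵘ.+ mkℚᵘ (+ suc p) e) ℚᵘ.* mkℚᵘ (+ m) 0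
  lhs = ℚᵘ.≃-trans (ℚ.toℚᵘ-homo-* (ℕ→ℚ 2 +ℚ ε) (ℕ→ℚ m))
    (ℚᵘ.*-cong (ℚᵘ.≃-trans (ℚ.toℚᵘ-homo-+ (ℕ→ℚ 2) ε) (ℚᵘ.+-congˡ (toℚᵘ ε) (toℚᵘ-ℕ 2))) (toℚᵘ-ℕ m))
... | *≤* le′ = begin
  (2 * suc e + 1) * m                  ≤⟨ *-monoˡ-≤ m (+-monoʳ-≤ (2 * suc e) (s≤s z≤n)) ⟩
  (2 * suc e + suc p * 1) * m          ≡⟨ *-identityʳ _ ⟨
  (2 * suc e + suc p * 1) * m * 1      ≤⟨ ℤ.drop‿+≤+ (subst₂ ℤ._≤_ numerator (sym (ℤ.pos-* l (1 * suc e * 1))) le′) ⟩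
  l * (1 * suc e * 1)                  ≡⟨ eq l (suc e) ⟩
  suc e * l                            ∎
  where
  open ≤-Reasoning
  eq : ∀ x y → x * (1 * y * 1) ≡ y * x
  eq = solve-∀
  numerator : (+ (2 * suc e + suc p * 1)) ℤ.* + m ℤ.* + 1 ≡ + ((2 * suc e + suc p * 1) * m * 1)
  numerator = trans (cong (ℤ._* + 1) (sym (ℤ.pos-* (2 * suc e + suc p * 1) m))) (sym (ℤ.pos-* ((2 * suc e + suc p * 1) * m) 1))

-- This is 1 / (k + 1), given directly in lowest terms so that its numerator and denominator
-- compute.
unitFraction : ℕ → ℚ
unitFraction k = mkℚ (+ 1) k (1-coprimeTo (suc k))

unitFraction-bound : ∀ {x m l k} → x * m ≤ l * suc k → unitFraction k *ℚ ℕ→ℚ x *ℚ ℕ→ℚ m ≤ℚ ℕ→ℚ l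
unitFraction-bound {x} {m} {l} {k} x*m≤ = ℚ.toℚᵘ-cancel-≤ (ℚᵘ.≤-respˡ-≃ (ℚᵘ.≃-sym lhs) (ℚᵘ.≤-respʳ-≃ (ℚᵘ.≃-sym (toℚᵘ-ℕ l))
  (*≤* (subst₂ ℤ._≤_ (sym numerator) (ℤ.pos-* l (suc k * 1 * 1)) (+≤+ (begin
    1 * x * m * 1            ≡⟨ eq₁ x m ⟩
    x * m                    ≤⟨ x*m≤ ⟩
    l * suc k                ≡⟨ eq₂ l (suc k) ⟩
    l * (suc k * 1 * 1)      ∎))))))
  where
  open ≤-Reasoning
  eq₁ : ∀ x m → 1 * x * m * 1 ≡ x * m
  eq₁ = solve-∀
  eq₂ : ∀ l k → l * k ≡ l * (k * 1 * 1)
  eq₂ = solve-∀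
  numerator : + 1 ℤ.* + x ℤ.* + m ℤ.* + 1 ≡ + (1 * x * m * 1)
  numerator = trans (cong (ℤ._* + 1) (trans (cong (ℤ._* + m) (sym (ℤ.pos-* 1 x))) (sym (ℤ.pos-* (1 * x) m)))) (sym (ℤ.pos-* (1 * x * m) 1))
  lhs : toℚᵘ (unitFraction k *ℚ ℕ→ℚ x *ℚ ℕ→ℚ m) ≃ mkℚᵘ (+ 1) k ℚᵘ.* mkℚᵘ (+ x) 0 ℚᵘ.* mkℚᵘ (+ m) 0
  lhs = ℚᵘ.≃-trans (ℚ.toℚᵘ-homo-* (unitFraction k *ℚ ℕ→ℚ x) (ℕ→ℚ m))
    (ℚᵘ.*-cong (ℚᵘ.≃-trans (ℚ.toℚᵘ-homo-* (unitFraction k) (ℕ→ℚ x)) (ℚᵘ.*-congˡ {toℚᵘ (unitFraction k)} (toℚᵘ-ℕ x))) (toℚᵘ-ℕ m))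

theorem1p7 : (s t : ℕ) (ε : ℚ) → 0ℚ <ℚ ε →
  Σ ℕ λ n₀ → Σ ℚ λ δ → 0ℚ <ℚ δ ×
  ((n : ℕ) → n ≥ n₀ → (F : List (Subset n)) → Unique F →
  (ℕ→ℚ 2 +ℚ ε) *ℚ ℕ→ℚ (midBinom n) ≤ℚ ℕ→ℚ (length F) →
  Σ (List (InducedCopy s t n F)) λ copies →
  AllPairs DistinctCopies copies ×
  δ *ℚ ℕ→ℚ (n ^ (s + t)) *ℚ ℕ→ℚ (midBinom n) ≤ℚ ℕ→ℚ (length copies))
theorem1p7 s t ε 0<ε = R , unitFraction K , *<*ℚ (+<+ (s≤s z≤n)) , manyCopies
  where
  open ≤-Reasoning
  -- With e the denominator of ε and d = 5 e, (2 + ε) - 2 (2 + d) / d ≥ 1 / e - 4 / d = 1 / d.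
  d Q R K : ℕ
  d = 5 * ↧ₙ ε
  -- With `M = n / R` and size threshold `M * Q`, this choice gives `4 * d * ((s + t) * M) ≤ M * Q`.
  -- The successor keeps `Q` positive when `s + t` is 0.
  Q = suc (4 * d * (s + t))
  R = (2 + d) * Q
  -- The factor `(2 * R) ^ (s + t)` is the loss in replacing `n` by `M`, and `d` is the loss in
  -- `supersaturation`.
  K = (2 * R) ^ (s + t) * d
  manyCopies : ∀ n → n ≥ R → (F : List (Subset n)) → Unique F →
    (ℕ→ℚ 2 +ℚ ε) *ℚ ℕ→ℚ (midBinom n) ≤ℚ ℕ→ℚ (length F) →
    Σ (List (InducedCopy s t n F)) λ copies →
    AllPairs DistinctCopies copies ×
    unitFraction K *ℚ ℕ→ℚ (n ^ (s + t)) *ℚ ℕ→ℚ (midBinom n) ≤ℚ ℕ→ℚ (length copies)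
  manyCopies n n≥R F F! large = rescale
    (supersaturation s t d (M * Q) M
      (*-mono-≤ 1≤M (s≤s z≤n))
      (begin
        4 * d * ((s + t) * M)    ≡⟨ *-CS.x∙yz≈z∙xy (4 * d) (s + t) M ⟩
        M * (4 * d * (s + t))    ≤⟨ *-monoʳ-≤ M (n≤1+n _) ⟩
        M * Q                    ∎)
      (begin
        (2 + d) * (M * Q)        ≡⟨ *-CS.x∙yz≈y∙xz (2 + d) M Q ⟩
        M * R                    ≤⟨ m/n*n≤m n R ⟩
        n                        ∎)
      F F!
      (begin
        (5 + 2 * d) * m                   ≡⟨ eq₂ (↧ₙ ε) m ⟩
        5 * ((2 * ↧ₙ ε + 1) * m)          ≤⟨ *-monoʳ-≤ 5 (size-bound {m} {length F} ε 0<ε large) ⟩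
        5 * (↧ₙ ε * length F)             ≡⟨ *-assoc 5 (↧ₙ ε) (length F) ⟨
        d * length F                      ∎))
    where
    m M : ℕ
    m = midBinom n
    M = n / R
    eq₁ : ∀ x y z → x * y * z ≡ y * (z * x)
    eq₁ = solve-∀
    eq₂ : ∀ e m → (5 + 2 * (5 * e)) * m ≡ 5 * ((2 * e + 1) * m)
    eq₂ = solve-∀
    eq₃ : ∀ M R → M * R + M * R ≡ M * (2 * R)
    eq₃ = solve-∀
    1≤M : 1 ≤ M
    1≤M = m≥n⇒m/n>0 n≥R
    -- Rounding down in `n / R` costs less than one `R`, hence at most a factor 2 because `M` is at
    -- least 1.
    n≤M*2R : n ≤ M * (2 * R)
    n≤M*2R = begin
      n                  ≤⟨ <⇒≤ (m<[1+m/n]*n n R) ⟩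
      R + M * R          ≤⟨ +-monoˡ-≤ (M * R) (≤-trans (≤-reflexive (sym (*-identityˡ R))) (*-monoˡ-≤ R 1≤M)) ⟩
      M * R + M * R      ≡⟨ eq₃ M R ⟩
      M * (2 * R)        ∎
    rescale : (Σ (List (InducedCopy s t n F)) λ copies →
        AllPairs DistinctCopies copies × m * M ^ (s + t) ≤ d * length copies) →
      Σ (List (InducedCopy s t n F)) λ copies →
        AllPairs DistinctCopies copies ×
        unitFraction K *ℚ ℕ→ℚ (n ^ (s + t)) *ℚ ℕ→ℚ m ≤ℚ ℕ→ℚ (length copies)
    rescale (copies , distinct , many) = copies , distinct , unitFraction-bound {n ^ (s + t)} {m} {length copies} (begin
      n ^ (s + t) * m                               ≤⟨ *-monoˡ-≤ m (^-monoˡ-≤ (s + t) n≤M*2R) ⟩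
      (M * (2 * R)) ^ (s + t) * m                   ≡⟨ cong (_* m) (^-distribʳ-* (s + t) M (2 * R)) ⟩
      M ^ (s + t) * (2 * R) ^ (s + t) * m           ≡⟨ eq₁ (M ^ (s + t)) ((2 * R) ^ (s + t)) m ⟩
      (2 * R) ^ (s + t) * (m * M ^ (s + t))         ≤⟨ *-monoʳ-≤ ((2 * R) ^ (s + t)) many ⟩
      (2 * R) ^ (s + t) * (d * length copies)       ≡⟨ *-CS.x∙yz≈z∙xy ((2 * R) ^ (s + t)) d (length copies) ⟩
      length copies * K                             ≤⟨ *-monoʳ-≤ (length copies) (n≤1+n K) ⟩
      length copies * suc K                         ∎)
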